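{- Let $A$ be a partially ordered set that is iteratively algebraic, i.e. $K^n(A)$ is algebraic for every natural number $n$. Then $A = K(A)$, i.e. every element of $A$ is compact.
   Context: A subset $X$ of a partially ordered set $L$ is directed if every finite subset of $X$ (including the empty subset) has an upper bound in $X$; in particular directed sets are nonempty. $L$ is upwards complete if every directed $X \subseteq L$ has a supremum $\bigvee X$ in $L$. For $X\subseteq L$, $(X] = \{y \in L \mid y \le x \text{ for some } x \in X\}$, and $(x] = (\{x\}]$. An element $k \in L$ is compact if for every directed $X \subseteq L$ that has a supremum in $L$, $k \le \bigvee X$ implies $k \le x$ for some $x \in X$. $K(L)$ denotes the set of compact elements of $L$ with the induced order. $L$ is algebraic if it is upwards complete and for every $x \in L$ the set $(x] \cap K(L)$ is directed and has supremum $x$ in $L$. Define $K^0(L) = L$ and $K^{n+1}(L) = K(K^n(L))$, each with the induced order; compactness in $K^{n+1}(L)$ is taken with respect to the order of $K^n(L)$ and suprema computed in $K^n(L)$. -}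

module Defs where

open import Level using (Level; _⊔_; Lift; Setω) renaming (suc to lsuc)
open import Data.Nat using (ℕ; zero; suc)
open import Data.Unit using (⊤)
open import Data.Product using (_×_; ∃; Σ-syntax)
open import Data.List using (List)
open import Data.List.Relation.Unary.All using (All)
open import Relation.Unary using (Pred)
open import Relation.Binary.Bundles using (Poset)

-- Throughout, a subposet of the poset P is represented by a predicate S on
-- the carrier of P, carrying the induced order.  K^n(P) is such a subset.
module _ {c ℓ₁ ℓ₂} (P : Poset c ℓ₁ ℓ₂) where
  open Poset P

  -- X ⊆ S is directed in S: every finite subset of X (given as a list of
  -- members of X, possibly empty) has an upper bound in X.
  Directed : ∀ {a b} → Pred Carrier a → Pred Carrier b → Set (c ⊔ ℓ₂ ⊔ a ⊔ b)
  Directed S X =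
    (∀ x → X x → S x) ×
    ((xs : List Carrier) → All X xs → ∃ λ u → X u × All (λ x → x ≤ u) xs)

  IsSup : ∀ {a b} → Pred Carrier a → Pred Carrier b → Carrier → Set (c ⊔ ℓ₂ ⊔ a ⊔ b)
  IsSup S X s =
    S s ×
    (∀ x → X x → x ≤ s) ×
    (∀ u → S u → (∀ x → X x → x ≤ u) → s ≤ u)

  UpComplete : ∀ {a} → Pred Carrier a → Set (c ⊔ ℓ₂ ⊔ lsuc a)
  UpComplete {a} S = (X : Pred Carrier a) → Directed S X → ∃ λ s → IsSup S X s

  Compact : ∀ {a} → Pred Carrier a → Pred Carrier (c ⊔ ℓ₂ ⊔ lsuc a)
  Compact {a} S k =
    S k ×
    ((X : Pred Carrier a) → Directed S X → (s : Carrier) → IsSup S X s →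
      k ≤ s → ∃ λ x → X x × k ≤ x)

  Algebraic : ∀ {a} → Pred Carrier a → Set (c ⊔ ℓ₂ ⊔ lsuc a)
  Algebraic S =
    UpComplete S ×
    (∀ x → S x →
      Directed S (λ y → y ≤ x × Compact S y) ×
      IsSup S (λ y → y ≤ x × Compact S y) x)

  lvl : ℕ → Level
  lvl zero = c ⊔ ℓ₁ ⊔ ℓ₂
  lvl (suc n) = c ⊔ ℓ₂ ⊔ lsuc (lvl n)

  Kⁿ : (n : ℕ) → Pred Carrier (lvl n)
  Kⁿ zero = λ _ → Lift (c ⊔ ℓ₁ ⊔ ℓ₂) ⊤
  Kⁿ (suc n) = Compact (Kⁿ n)

  IterativelyAlgebraic : Setω
  IterativelyAlgebraic = (n : ℕ) → Algebraic (Kⁿ n)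

{-# OPTIONS --safe #-}
-- Let ρₙ₊₁(x) be the supremum in Kⁿ⁺¹(A) of the elements of Kⁿ⁺¹(A) below ρₙ(x),
-- with ρ₀(x) = x.  Then ρₙ is a closure operator onto Kⁿ(A), so y ∈ Kⁿ(A) is
-- equivalent to ρₙ(y) ≤ y, and if ρₙ(x) ∈ Kⁿ⁺¹(A) for some n then x ∈ K(A).
-- Call an increasing sequence u with uₙ ∈ Kⁿ(A) a witness if uₙ ∈ Kⁿ⁺¹(A), for any
-- n, implies x ∈ K(A); so ρ(x) is one.  As in Pataraia's fixed point theorem, the
-- monotone inflationary maps f on witnesses are directed under composition, and
--   (T u)ₙ = the supremum in Kⁿ(A) of all (f u)ₘ with m ≥ n
-- is again such a map.  Taking f = T gives (T u)₁ ≤ (T u)₀, so (T u)₀ ∈ K(A).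
module Submission where

open import Defs
open import Level using (_⊔_; Lift; lift)
open import Data.Nat using (ℕ; zero; suc; s≤s; _≤′_; ≤′-refl; ≤′-step) renaming (_≤_ to _≤ᴺ_; _⊔_ to _⊔ᴺ_)
open import Data.Nat.Properties using (m≤m⊔n; m≤n⊔m; n≤1+n; m≤n⇒m≤1+n; ≤⇒≤′)
  renaming (≤-refl to ≤ᴺ-refl; ≤-trans to ≤ᴺ-trans)
open import Data.Product using (_×_; ∃; Σ-syntax; _,_; proj₁; proj₂)
open import Data.List using (List; []; _∷_)
open import Data.List.Relation.Unary.All as All using (All; []; _∷_)
open import Relation.Unary using (Pred)
open import Relation.Binary.Bundles using (Poset)
open import Relation.Binary.PropositionalEquality using (_≡_; refl)

module _ {c ℓ₁ ℓ₂} (P : Poset c ℓ₁ ℓ₂) where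
  open Poset P renaming (refl to ≤-refl; trans to ≤-trans)

  directed-from-pairs : ∀ {a b} {S : Pred Carrier a} {X : Pred Carrier b} →
    (∀ x → X x → S x) → ∃ X →
    (∀ {x y} → X x → X y → ∃ λ z → X z × x ≤ z × y ≤ z) → Directed P S X
  directed-from-pairs {X = X} X⊆S inhabited bound = X⊆S , bounds
    where
    bounds : (xs : List Carrier) → All X xs → ∃ λ u → X u × All (λ x → x ≤ u) xs
    bounds [] [] = proj₁ inhabited , proj₂ inhabited , []
    bounds (x ∷ xs) (Xx ∷ Xxs) with bounds xs Xxs
    ... | u , Xu , xs≤u with bound Xx Xu
    ... | z , Xz , x≤z , u≤z = z , Xz , x≤z ∷ All.map (λ y≤u → ≤-trans y≤u u≤z) xs≤u

  Kⁿ-resp-≈ : ∀ n {x y} → x ≈ y → Kⁿ P n x → Kⁿ P n y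
  Kⁿ-resp-≈ zero _ k = lift _
  Kⁿ-resp-≈ (suc n) x≈y (Sx , compact) =
    Kⁿ-resp-≈ n x≈y Sx ,
    λ X dir s sup y≤s → let (z , Xz , x≤z) = compact X dir s sup (≤-trans (reflexive x≈y) y≤s)
                        in z , Xz , ≤-trans (reflexive (Eq.sym x≈y)) x≤z

  Kⁿ-anti-≤ : ∀ {m n x} → m ≤ᴺ n → Kⁿ P n x → Kⁿ P m x
  Kⁿ-anti-≤ {x = x} m≤n = go (≤⇒≤′ m≤n)
    where
    go : ∀ {m n} → m ≤′ n → Kⁿ P n x → Kⁿ P m x
    go ≤′-refl k = k
    go (≤′-step m≤n) k = go m≤n (proj₁ k)

  -- For a variable n the level lvl n does not absorb c ⊔ ℓ₂, so small types are
  -- lifted along the recursion defining lvl.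
  Liftⁿ : ∀ n → Set (c ⊔ ℓ₂) → Set (lvl P n)
  Liftⁿ zero X = Lift (lvl P zero) X
  Liftⁿ (suc n) X = Lift (lvl P (suc n)) (Liftⁿ n X)

  liftⁿ : ∀ n {X} → X → Liftⁿ n X
  liftⁿ zero x = lift x
  liftⁿ (suc n) x = lift (liftⁿ n x)

  lowerⁿ : ∀ n {X} → Liftⁿ n X → X
  lowerⁿ zero (lift x) = x
  lowerⁿ (suc n) (lift x) = lowerⁿ n x

module _ {c ℓ₁ ℓ₂} (A : Poset c ℓ₁ ℓ₂) (algebraic : IterativelyAlgebraic A) where
  open Poset A renaming (refl to ≤-refl; trans to ≤-trans)

  K : ∀ n → Pred Carrier (lvl A n)
  K = Kⁿ A

  ↓K : ∀ n → Carrier → Pred Carrier (lvl A (suc n))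
  ↓K n x y = y ≤ x × K (suc n) y

  -- Algebraicity gives directedness inside `K n`; since all members of the set lie in `K (suc n)`,
  -- the ambient subposet can be changed.
  ↓K-directed : ∀ n {x} → K n x → Directed A (K (suc n)) (↓K n x)
  ↓K-directed n {x} k = (λ _ → proj₂) , proj₂ (proj₁ (proj₂ (algebraic n) x k))

  closure : ∀ n → Carrier → Σ[ y ∈ Carrier ] K n y
  ↓K-sup : ∀ n x → ∃ (IsSup A (K (suc n)) (↓K n (proj₁ (closure n x))))

  closure zero x = x , lift _
  closure (suc n) x = let (s , Ks , _) = ↓K-sup n x in s , Ks

  ↓K-sup n x = proj₁ (algebraic (suc n)) _ (↓K-directed n (proj₂ (closure n x)))

  ρ : ∀ n → Carrier → Carrier
  ρ n x = proj₁ (closure n x)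

  ρ∈K : ∀ n x → K n (ρ n x)
  ρ∈K n x = proj₂ (closure n x)

  -- By algebraicity `ρ n x` is the supremum in `K n` of `↓K n (ρ n x)`; `ρ (suc n) x` is an upper
  -- bound of the same set and also lies in `K n`.
  ρ-step : ∀ n x → ρ n x ≤ ρ (suc n) x
  ρ-step n x =
    let (_ , _ , least) = proj₂ (proj₂ (algebraic n) (ρ n x) (ρ∈K n x))
        (_ , upper , _) = proj₂ (↓K-sup n x)
    in least _ (proj₁ (ρ∈K (suc n) x)) upper

  ρ-inflationary : ∀ n x → x ≤ ρ n x
  ρ-inflationary zero x = ≤-refl
  ρ-inflationary (suc n) x = ≤-trans (ρ-inflationary n x) (ρ-step n x)

  ρ-mono : ∀ n {x y} → x ≤ y → ρ n x ≤ ρ n y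
  ρ-mono zero x≤y = x≤y
  ρ-mono (suc n) {x} {y} x≤y =
    let (_ , _ , least) = proj₂ (↓K-sup n x)
        (_ , upper , _) = proj₂ (↓K-sup n y)
    in least _ (ρ∈K (suc n) y)
         λ z (z≤ , Kz) → upper z (≤-trans z≤ (ρ-mono n x≤y) , Kz)

  K⇒ρ≤ : ∀ n {x} → K n x → ρ n x ≤ x
  K⇒ρ≤ zero _ = ≤-refl
  K⇒ρ≤ (suc n) {x} k =
    let (_ , _ , least) = proj₂ (↓K-sup n x)
    in least x k λ z (z≤ , _) → ≤-trans z≤ (K⇒ρ≤ n (proj₁ k))

  ρ≤⇒K : ∀ n {x} → ρ n x ≤ x → K n x
  ρ≤⇒K n {x} ρ≤ = Kⁿ-resp-≈ A n (antisym ρ≤ (ρ-inflationary n x)) (ρ∈K n x)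

  -- If ρₙ₊₁(x) is compact in Kⁿ⁺¹(A), it lies below a member of the set ↓K n (ρₙ x)
  -- of which it is the supremum; hence ρₙ₊₁(x) = ρₙ(x).
  ρ-compact⇒compact : ∀ n x → K (suc n) (ρ n x) → K 1 x
  ρ-compact⇒compact zero x k = k
  ρ-compact⇒compact (suc n) x (_ , compact) =
    let (d , (d≤ , _) , ρ≤d) = compact (↓K n (ρ n x)) (↓K-directed n (ρ∈K n x)) _
                                 (proj₂ (↓K-sup n x)) ≤-refl
    in ρ-compact⇒compact n x
         (Kⁿ-resp-≈ A (suc n) (antisym (≤-trans ρ≤d d≤) (ρ-step n x)) (ρ∈K (suc n) x))

  module _ (x : Carrier) where

    -- Membership in Kⁿ(A) is expressed through ρ, since then witnesses and their
    -- endomaps form small types although the level of Kⁿ grows with n.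
    record Witness : Set (c ⊔ ℓ₂) where
      field
        seq : ℕ → Carrier
        seq-closed : ∀ n → ρ n (seq n) ≤ seq n
        seq-step : ∀ n → seq n ≤ seq (suc n)
        seq-compact : ∀ n → ρ (suc n) (seq n) ≤ seq n → ρ 1 x ≤ x

      seq-mono : ∀ {m n} → m ≤ᴺ n → seq m ≤ seq n
      seq-mono m≤n = go (≤⇒≤′ m≤n)
        where
        go : ∀ {m n} → m ≤′ n → seq m ≤ seq n
        go ≤′-refl = ≤-refl
        go (≤′-step m≤n) = ≤-trans (go m≤n) (seq-step _)

      -- `seq n` then coincides with `seq (suc n)`, which is closed for `ρ (suc n)`.
      seq-stable : ∀ n → seq (suc n) ≤ seq n → ρ 1 x ≤ x
      seq-stable n ≤seq = seq-compact n
        (≤-trans (ρ-mono (suc n) (seq-step n)) (≤-trans (seq-closed (suc n)) ≤seq))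

    open Witness

    _⊑_ : Witness → Witness → Set ℓ₂
    u ⊑ v = ∀ n → seq u n ≤ seq v n

    record Inflation : Set (c ⊔ ℓ₂) where
      field
        map : Witness → Witness
        inflationary : ∀ u → u ⊑ map u
        mono : ∀ {u v} → u ⊑ v → map u ⊑ map v

    open Inflation

    identity : Inflation
    identity = record { map = λ u → u ; inflationary = λ _ _ → ≤-refl ; mono = λ u⊑v → u⊑v }

    _∘ᴵ_ : Inflation → Inflation → Inflation
    g ∘ᴵ f = record
      { map = λ u → map g (map f u)
      ; inflationary = λ u n → ≤-trans (inflationary f u n) (inflationary g (map f u) n)
      ; mono = λ u⊑v → mono g (mono f u⊑v)
      }

    -- As `Inflation` is small, `f` can range over all inflations, including the one later built
    -- from suprema of these very sets.
    Tail : Witness → ℕ → Pred Carrier (c ⊔ ℓ₂)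
    Tail u n y = Σ[ f ∈ Inflation ] Σ[ m ∈ ℕ ] (n ≤ᴺ m × y ≡ seq (map f u) m)

    tail-directed : ∀ u n → Directed A (K n) (λ y → Liftⁿ A n (Tail u n y))
    tail-directed u n = directed-from-pairs A
      (λ y t → tail⊆K (lowerⁿ A n t))
      (seq u n , liftⁿ A n (identity , n , ≤ᴺ-refl , refl))
      (λ s t → let (z , Tz , le) = bound (lowerⁿ A n s) (lowerⁿ A n t)
               in z , liftⁿ A n Tz , le)
      where
      tail⊆K : ∀ {y} → Tail u n y → K n y
      tail⊆K (f , m , n≤m , refl) = Kⁿ-anti-≤ A n≤m (ρ≤⇒K m (seq-closed (map f u) m))

      -- `g ∘ᴵ f` dominates `f` because `g` is inflationary, and `g` because `g` is monotone and `f`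
      -- inflationary.
      bound : ∀ {y z} → Tail u n y → Tail u n z → ∃ λ w → Tail u n w × y ≤ w × z ≤ w
      bound (f , i , n≤i , refl) (g , j , n≤j , refl) =
        _ , (g ∘ᴵ f , i ⊔ᴺ j , ≤ᴺ-trans n≤i (m≤m⊔n i j) , refl) ,
        ≤-trans (inflationary g (map f u) i) (seq-mono (map g (map f u)) (m≤m⊔n i j)) ,
        ≤-trans (mono g (inflationary f u) j) (seq-mono (map g (map f u)) (m≤n⊔m i j))

    tail-sup : ∀ u n → ∃ (IsSup A (K n) (λ y → Liftⁿ A n (Tail u n y)))
    tail-sup u n = proj₁ (algebraic n) _ (tail-directed u n)

    top : Witness → ℕ → Carrier
    top u n = proj₁ (tail-sup u n)

    top∈K : ∀ u n → K n (top u n)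
    top∈K u n = proj₁ (proj₂ (tail-sup u n))

    top-upper : ∀ u f {n m} → n ≤ᴺ m → seq (map f u) m ≤ top u n
    top-upper u f {n} n≤m =
      proj₁ (proj₂ (proj₂ (tail-sup u n))) _ (liftⁿ A n (f , _ , n≤m , refl))

    top-least : ∀ u n {b} → K n b →
      (∀ f {m} → n ≤ᴺ m → seq (map f u) m ≤ b) → top u n ≤ b
    top-least u n {b} Kb upper =
      proj₂ (proj₂ (proj₂ (tail-sup u n))) b Kb λ _ t → bounded (lowerⁿ A n t)
      where
      bounded : ∀ {y} → Tail u n y → y ≤ b
      bounded (f , _ , n≤m , refl) = upper f n≤m

    -- Compactness places the supremum below some `seq (map f u) m`. The term at `suc m` is in the
    -- same tail, so this sequence is stable at `m`.
    top-compact : ∀ u n → K (suc n) (top u n) → ρ 1 x ≤ x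
    top-compact u n (_ , compact)
      with compact _ (tail-directed u n) _ (proj₂ (tail-sup u n)) ≤-refl
    ... | _ , t , top≤ with lowerⁿ A n t
    ... | f , m , n≤m , refl =
      seq-stable (map f u) m (≤-trans (top-upper u f (m≤n⇒m≤1+n n≤m)) top≤)

    greatest : Inflation
    greatest = record
      { map = λ u → record
        { seq = top u
        ; seq-closed = λ n → K⇒ρ≤ n (top∈K u n)
        -- A term with index `m ≥ n` is bounded by the next one, whose index is at least `suc n`.
        ; seq-step = λ n → top-least u n (proj₁ (top∈K u (suc n)))
            λ f {m} n≤m → ≤-trans (seq-step (map f u) m) (top-upper u f (s≤s n≤m))
        ; seq-compact = λ n ρ≤ → top-compact u n (ρ≤⇒K (suc n) ρ≤)
        }
      ; inflationary = λ u n → top-upper u identity ≤ᴺ-refl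
      ; mono = λ {u} {v} u⊑v n → top-least u n (top∈K v n)
          λ f {m} n≤m → ≤-trans (mono f u⊑v m) (top-upper v f n≤m)
      }

    closures : Witness
    closures = record
      { seq = λ n → ρ n x
      ; seq-closed = λ n → K⇒ρ≤ n (ρ∈K n x)
      ; seq-step = λ n → ρ-step n x
      ; seq-compact = λ n ρ≤ → K⇒ρ≤ 1 (ρ-compact⇒compact n x (ρ≤⇒K (suc n) ρ≤))
      }

    compact-element : K 1 x
    compact-element = ρ≤⇒K 1
      -- `greatest` occurs among the inflations in its own tail at level 0, here with index 1.
      (seq-stable (map greatest closures) 0 (top-upper closures greatest (n≤1+n 0)))

mainTheorem1 : ∀ {c ℓ₁ ℓ₂} (A : Poset c ℓ₁ ℓ₂) → IterativelyAlgebraic A →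
    ∀ x → Compact A (Kⁿ A 0) x
mainTheorem1 A algebraic = compact-element A algebraic
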